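{- Let $A\subseteq\omega$ be an infinite c.e. set, $n\ge1$, and let $\theta^{(n)}$ be a quasi-Gödel numbering of $\mathcal S^{(n)}_A$. Then there is no function $p\in\mathcal R^{(1)}$ such that for all $i\in\omega$: if $\theta^{(n)}_i\in\mathrm{Anf}^{(n)}_A$, then $p(i)$ is the edge length of $\mathrm{dom}(\theta^{(n)}_i)$.
   Context: $\omega$ is the set of natural numbers; $\mathcal R^{(n)}$ is the set of total computable functions $\omega^n\to\omega$. $\langle\cdot,\cdot\rangle:\omega^2\to\omega$ is a computable bijection with $\langle x,y\rangle\ge x,y$, extended by $\langle x\rangle=x$, $\langle x_1,\dots,x_{n+1}\rangle=\langle x_1,\langle x_2,\dots,x_{n+1}\rangle\rangle$. The edge length of a set of the form $\{0,\dots,a-1\}^n$ is $a$; the empty set has edge length $0$. $\mathrm{Anf}^{(n)}_A$ is the set of partial functions from $\omega^n$ to $\omega$ whose domain is either empty or equal to $\{0,\dots,a-1\}^n$ for some $a\in A$, and $\mathcal S^{(n)}_A=\mathcal R^{(n)}\cup\mathrm{Anf}^{(n)}_A$. The extended graph of an $n$-ary partial function $q$ is $\{\langle\langle\vec y\rangle,0\rangle:\vec y\in\omega^n\}\cup\{\langle\langle\vec x\rangle,q(\vec x)+1\rangle:\vec x\in\mathrm{dom}(q)\}$. A numbering of a set $X$ is a surjection $\omega\to X$. A numbering $\theta$ of $\mathcal S^{(n)}_A$ is a quasi-Gödel numbering if: (QGN I) the extended graph of $(i,\vec x)\mapsto\theta_i(\vec x)$ is the range of a function in $\mathcal R^{(1)}$;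 and (QGN II) for every $k\in\mathcal R^{(2)}$ there is $v\in\mathcal R^{(1)}$ such that for all $i\in\omega$, $r\in\mathcal S^{(n)}_A$: if $\{k(i,t):t\in\omega\}$ is the extended graph of $r$, then $r=\theta_{v(i)}$. -}

module Defs where

open import Data.Fin using (Fin)
open import Data.Nat using (ℕ; zero; suc; _<_; _≥_)
open import Data.Product using (_×_; ∃; ∃-syntax; uncurry)
open import Data.Sum using (_⊎_)
open import Data.Vec using (Vec; []; _∷_; [_]; lookup)
open import Data.Vec.Relation.Binary.Pointwise.Inductive using (Pointwise)
open import Data.Vec.Relation.Unary.All using (All)
open import Function.Bundles using () renaming (_⇔_ to _iff_)
open import Function.Definitions using (Bijective)
open import Level using (0ℓ)
open import Relation.Binary.Core using (REL; _⇔_)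
open import Relation.Binary.PropositionalEquality using (_≡_)
open import Relation.Nullary using (¬_)
open import Relation.Unary using (Pred; _∈_; _≐_; Empty)

-- Kleene's partial recursive functions: programs and their graphs.

data Rec : ℕ → Set where
  zeroᵣ : ∀ {n} → Rec n
  sucᵣ  : Rec 1
  proj  : ∀ {n} → Fin n → Rec n
  comp  : ∀ {m n} → Rec m → Vec (Rec n) m → Rec n
  prec  : ∀ {n} → Rec n → Rec (suc (suc n)) → Rec (suc n)
  mu    : ∀ {n} → Rec (suc n) → Rec n

infix 4 _$_⇓_

data _$_⇓_ : ∀ {n} → Rec n → Vec ℕ n → ℕ → Set where
  ⇓zero  : ∀ {n} {xs : Vec ℕ n} → zeroᵣ $ xs ⇓ 0
  ⇓suc   : ∀ {x} → sucᵣ $ [ x ] ⇓ suc x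
  ⇓proj  : ∀ {n} {i : Fin n} {xs} → proj i $ xs ⇓ lookup xs i
  ⇓comp  : ∀ {m n} {f : Rec m} {gs : Vec (Rec n) m} {xs ys z} →
           Pointwise (λ g y → g $ xs ⇓ y) gs ys → f $ ys ⇓ z →
           comp f gs $ xs ⇓ z
  ⇓prec₀ : ∀ {n} {f : Rec n} {g xs y} →
           f $ xs ⇓ y → prec f g $ 0 ∷ xs ⇓ y
  ⇓precₛ : ∀ {n} {f : Rec n} {g k xs y z} →
           prec f g $ k ∷ xs ⇓ y → g $ k ∷ y ∷ xs ⇓ z →
           prec f g $ suc k ∷ xs ⇓ z
  ⇓mu    : ∀ {n} {f : Rec (suc n)} {xs y} →
           f $ y ∷ xs ⇓ 0 →
           (∀ z → z < y → ∃[ w ] f $ z ∷ xs ⇓ suc w) →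
           mu f $ xs ⇓ y

-- f ∈ 𝓡⁽ⁿ⁾; totality is built into the type of f.
Computable : ∀ {n} → (Vec ℕ n → ℕ) → Set
Computable {n} f = ∃[ c ] (∀ xs → c $ xs ⇓ f xs)

-- Computably enumerable: the domain of a unary partial recursive function.
CE : Pred ℕ 0ℓ → Set
CE A = ∃[ c ] (∀ x → A x iff (∃[ y ] c $ [ x ] ⇓ y))

Range : (ℕ → ℕ) → Pred ℕ 0ℓ
Range f x = ∃[ t ] f t ≡ x

record Pairing : Set where
  field
    ⟨_,_⟩      : ℕ → ℕ → ℕ
    computable : Computable {2} (λ { (x ∷ y ∷ []) → ⟨ x , y ⟩ })
    bijective  : Bijective _≡_ _≡_ (uncurry ⟨_,_⟩)
    ≥-left     : ∀ x y → ⟨ x , y ⟩ ≥ x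
    ≥-right    : ∀ x y → ⟨ x , y ⟩ ≥ y

-- Partial functions are single-valued relations, because a map into Maybe ℕ
-- would come with a decision procedure for its domain.
record PartialFunction (n : ℕ) : Set₁ where
  field
    Graph      : REL (Vec ℕ n) ℕ 0ℓ
    functional : ∀ {x y z} → Graph x y → Graph x z → y ≡ z

open PartialFunction public

infix 4 _≈_

_≈_ : ∀ {n} → PartialFunction n → PartialFunction n → Set
q ≈ r = Graph q ⇔ Graph r

Dom : ∀ {n} → PartialFunction n → Pred (Vec ℕ n) 0ℓ
Dom q x = ∃[ y ] Graph q x y

-- {0, …, a-1}ⁿ
Cube : ∀ n → ℕ → Pred (Vec ℕ n) 0ℓ
Cube n a = All (_< a)

data EdgeLength {n} (D : Pred (Vec ℕ n) 0ℓ) : ℕ → Set where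
  cube  : ∀ {a} → D ≐ Cube n a → EdgeLength D a
  empty : Empty D → EdgeLength D 0

Anf : ∀ n → Pred ℕ 0ℓ → Pred (PartialFunction n) 0ℓ
Anf n A q = Empty (Dom q) ⊎ (∃[ a ] a ∈ A × Dom q ≐ Cube n a)

TotalComputable : ∀ n → Pred (PartialFunction n) 0ℓ
TotalComputable n q = ∃[ f ] Computable f × Graph q ⇔ (λ x y → f x ≡ y)

𝓢 : ∀ n → Pred ℕ 0ℓ → Pred (PartialFunction n) 0ℓ
𝓢 n A q = q ∈ TotalComputable n ⊎ q ∈ Anf n A

-- (i , x⃗) ↦ θ i x⃗
universal : ∀ {n} → (ℕ → PartialFunction n) → PartialFunction (suc n)
universal θ .Graph (i ∷ x) y = Graph (θ i) x y
universal θ .functional {i ∷ x} = functional (θ i)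

-- Membership of θ i is double-negated: 𝓢 is a disjunction, so without the
-- negations the numbering would have to decide which θ i are total.
-- Classically this is exactly a surjection from ℕ onto S.
record IsNumbering {n} (S : Pred (PartialFunction n) 0ℓ)
                   (θ : ℕ → PartialFunction n) : Set₁ where
  field
    into : ∀ i → ¬ ¬ (θ i ∈ S)
    onto : ∀ q → q ∈ S → ∃[ i ] θ i ≈ q

module _ (π : Pairing) where
  open Pairing π

  tuple : ∀ {n} → Vec ℕ (suc n) → ℕ
  tuple (x ∷ [])     = x
  tuple (x ∷ y ∷ ys) = ⟨ x , tuple (y ∷ ys) ⟩

  ExtendedGraph : ∀ {n} → PartialFunction (suc n) → Pred ℕ 0ℓ
  ExtendedGraph {n} q c =
    (∃[ y ] c ≡ ⟨ tuple {n} y , 0 ⟩) ⊎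
    (∃[ x ] ∃[ z ] Graph q x z × c ≡ ⟨ tuple {n} x , suc z ⟩)

  QGN-I : ∀ {n} → (ℕ → PartialFunction n) → Set
  QGN-I θ = ∃[ f ] Computable {1} f ×
    ExtendedGraph (universal θ) ≐ Range (λ t → f [ t ])

  QGN-II : ∀ {m} → Pred ℕ 0ℓ → (ℕ → PartialFunction (suc m)) → Set₁
  QGN-II {m} A θ =
    ∀ k → Computable {2} k →
    ∃[ v ] Computable {1} v ×
      (∀ i r → r ∈ 𝓢 (suc m) A →
        Range (λ t → k (i ∷ t ∷ [])) ≐ ExtendedGraph r →
        r ≈ θ (v [ i ]))

  -- The arity n ≥ 1 is written suc m.
  record IsQuasiGödelNumbering {m} (A : Pred ℕ 0ℓ)
                               (θ : ℕ → PartialFunction (suc m)) : Set₁ where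
    field
      isNumbering : IsNumbering (𝓢 (suc m) A) θ
      qgn-I       : QGN-I θ
      qgn-II      : QGN-II A θ

{-# OPTIONS --safe #-}
-- The set K = { i : θ i (i, …, i) = 0 } is c.e. by QGN-I, and it is undecidable
-- because θ enumerates all total computable functions.  Fix a positive a ∈ A and
-- let r i be the zero function on {0, …, a-1}ⁿ if i ∈ K and the empty function
-- otherwise.  The extended graph of r i is enumerable uniformly in i, so QGN-II
-- gives a computable v with r i = θ (v i).  An edge length function p would then
-- decide K, since i ∈ K exactly when p (v i) ≠ 0.
module Submission where

open import Defs
open import Data.Empty using (⊥-elim)
open import Data.Fin using (zero; suc)
open import Data.Nat using (ℕ; zero; suc; _+_; _*_; _∸_; _≤_; _<_; z≤n; s≤s)
open import Data.Nat.InfinitelyOften using (Inf)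
open import Data.Nat.Properties
open import Data.Product using (_×_; ∃-syntax; _,_; proj₁; proj₂; map₂)
open import Data.Sum using (inj₁; inj₂)
open import Data.Vec using (Vec; []; _∷_; [_]; head; lookup; replicate)
open import Data.Vec.Relation.Binary.Pointwise.Inductive using ([]; _∷_)
open import Data.Vec.Relation.Unary.All using ([]; _∷_)
open import Function.Base using (_∘_)
open import Level using (0ℓ)
open import Relation.Binary.PropositionalEquality
  using (_≡_; _≢_; refl; sym; trans; cong; cong₂; subst)
open import Relation.Nullary using (¬_)
open import Relation.Unary using (Pred; _∈_; _≐_; Empty)

-- Closure properties of the computable functions.

Computable₂ : (ℕ → ℕ → ℕ) → Set
Computable₂ _·_ = Computable {2} (λ xs → lookup xs zero · lookup xs (suc zero))

module _ {n : ℕ} where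

  computable-resp : {f g : Vec ℕ n → ℕ} → (∀ xs → f xs ≡ g xs) →
                    Computable f → Computable g
  computable-resp f≗g (c , c⇓) = c , λ xs → subst (c $ xs ⇓_) (f≗g xs) (c⇓ xs)

  computable-lookup : ∀ i → Computable {n} (λ xs → lookup xs i)
  computable-lookup i = proj i , λ _ → ⇓proj

  computable-∘₁ : ∀ {f : Vec ℕ 1 → ℕ} {g : Vec ℕ n → ℕ} →
                  Computable f → Computable g → Computable (λ xs → f [ g xs ])
  computable-∘₁ (c , c⇓) (d , d⇓) =
    comp c (d ∷ []) , λ xs → ⇓comp (d⇓ xs ∷ []) (c⇓ _)

  computable-∘₂ : ∀ _·_ {f g : Vec ℕ n → ℕ} → Computable₂ _·_ →
                  Computable f → Computable g → Computable (λ xs → f xs · g xs)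
  computable-∘₂ _ (c , c⇓) (d , d⇓) (e , e⇓) =
    comp c (d ∷ e ∷ []) , λ xs → ⇓comp (d⇓ xs ∷ e⇓ xs ∷ []) (c⇓ (_ ∷ _ ∷ []))

  computable-suc : ∀ {f : Vec ℕ n → ℕ} → Computable f → Computable (suc ∘ f)
  computable-suc (c , c⇓) = comp sucᵣ (c ∷ []) , λ xs → ⇓comp (c⇓ xs ∷ []) ⇓suc

  computable-const : ∀ a → Computable {n} (λ _ → a)
  computable-const zero    = zeroᵣ , λ _ → ⇓zero
  computable-const (suc a) = computable-suc (computable-const a)

  -- `h` is given beforehand and only has to satisfy the recursion equations, so that functions
  -- already defined in Agda can be shown computable.
  computable-prec : ∀ {f : Vec ℕ n → ℕ} {g} {h : Vec ℕ (suc n) → ℕ} →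
                    Computable f → Computable g →
                    (∀ xs → f xs ≡ h (0 ∷ xs)) →
                    (∀ k xs → g (k ∷ h (k ∷ xs) ∷ xs) ≡ h (suc k ∷ xs)) →
                    Computable h
  computable-prec {h = h} (c , c⇓) (d , d⇓) h-zero h-suc =
    prec c d , λ { (k ∷ xs) → eval k xs }
    where
    eval : ∀ k xs → prec c d $ k ∷ xs ⇓ h (k ∷ xs)
    eval zero    xs = ⇓prec₀ (subst (c $ xs ⇓_) (h-zero xs) (c⇓ xs))
    eval (suc k) xs =
      ⇓precₛ (eval k xs) (subst (d $ _ ⇓_) (h-suc k xs) (d⇓ _))

  -- Minimisation finds the least zero; uniqueness makes all values below `h xs` positive, as `⇓mu`
  -- demands.
  computable-uniqueZero : ∀ {g : Vec ℕ (suc n) → ℕ} {h : Vec ℕ n → ℕ} →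
                          Computable g → (∀ xs → g (h xs ∷ xs) ≡ 0) →
                          (∀ y xs → g (y ∷ xs) ≡ 0 → y ≡ h xs) → Computable h
  computable-uniqueZero {g} {h} (c , c⇓) zero! unique = mu c , λ xs →
    ⇓mu (subst (c $ _ ⇓_) (zero! xs) (c⇓ _)) (λ z z<h → positive z xs z<h)
    where
    positive : ∀ z xs → z < h xs → ∃[ w ] c $ z ∷ xs ⇓ suc w
    positive z xs z<h with g (z ∷ xs) in eq
    ... | zero  = ⊥-elim (<⇒≢ z<h (unique z xs eq))
    ... | suc w = w , subst (c $ _ ⇓_) eq (c⇓ _)

-- Arithmetic, equality tests and bounded quantification.

computable-+ : Computable₂ _+_
computable-+ = computable-prec
  (computable-lookup zero) (computable-suc (computable-lookup (suc zero)))
  (λ _ → refl) (λ _ _ → refl)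

computable-* : Computable₂ _*_
computable-* = computable-prec
  (computable-const 0)
  (computable-∘₂ _+_ computable-+ (computable-lookup (suc (suc zero)))
                                  (computable-lookup (suc zero)))
  (λ _ → refl) (λ _ _ → refl)

computable-∸ : Computable₂ _∸_
-- `prec` recurses on the first argument, but iterating the predecessor recurses on the subtrahend,
-- hence the flip.
computable-∸ = computable-∘₂ (λ x y → y ∸ x) computable-flip-∸
  (computable-lookup (suc zero)) (computable-lookup zero)
  where
  computable-pred : Computable {1} (λ xs → lookup xs zero ∸ 1)
  computable-pred = computable-prec (computable-const 0) (computable-lookup zero)
    (λ _ → refl) (λ _ _ → refl)

  computable-flip-∸ : Computable₂ (λ x y → y ∸ x)
  computable-flip-∸ = computable-prec (computable-lookup zero)
    (computable-∘₁ computable-pred (computable-lookup (suc zero)))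
    (λ _ → refl)
    (λ k xs → trans (∸-+-assoc (lookup xs zero) k 1)
                    (cong (lookup xs zero ∸_) (+-comm k 1)))

-- The absolute difference, as one summand always vanishes. It turns equality into a test for zero.
distance : ℕ → ℕ → ℕ
distance x y = (x ∸ y) + (y ∸ x)

distance≡0⇒≡ : ∀ x y → distance x y ≡ 0 → x ≡ y
distance≡0⇒≡ x y eq = ≤-antisym (m∸n≡0⇒m≤n (m+n≡0⇒m≡0 (x ∸ y) eq))
                                (m∸n≡0⇒m≤n (m+n≡0⇒n≡0 (x ∸ y) eq))

≡⇒distance≡0 : ∀ {x y} → x ≡ y → distance x y ≡ 0
≡⇒distance≡0 {x} refl = cong₂ _+_ (n∸n≡0 x) (n∸n≡0 x)

computable-distance : Computable₂ distance
computable-distance = computable-∘₂ _+_ computable-+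
  computable-∸
  (computable-∘₂ _∸_ computable-∸ (computable-lookup (suc zero))
                                  (computable-lookup zero))

-- Serves as a bounded existential quantifier: the product vanishes exactly when one of its factors
-- does.
∏[_]_ : ℕ → (ℕ → ℕ) → ℕ
∏[ zero  ] f = 1
∏[ suc k ] f = f k * ∏[ k ] f

∏≡0⇒∃ : ∀ k f → ∏[ k ] f ≡ 0 → ∃[ j ] f j ≡ 0
∏≡0⇒∃ (suc k) f eq with m*n≡0⇒m≡0∨n≡0 (f k) eq
... | inj₁ fk≡0 = k , fk≡0
... | inj₂ eq′  = ∏≡0⇒∃ k f eq′

<⇒∏≡0 : ∀ {k j f} → j < k → f j ≡ 0 → ∏[ k ] f ≡ 0
<⇒∏≡0 {suc k} {j} {f} (s≤s j≤k) fj≡0 with m≤n⇒m<n∨m≡n j≤k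
... | inj₁ j<k  = trans (cong (f k *_) (<⇒∏≡0 j<k fj≡0)) (*-zeroʳ (f k))
... | inj₂ refl = cong (_* ∏[ k ] f) fj≡0

-- Projections of the pairing, coding of tuples and cubes.

module _ (π : Pairing) where
  open Pairing π

  ⟨,⟩-injective : ∀ {x y x′ y′} → ⟨ x , y ⟩ ≡ ⟨ x′ , y′ ⟩ → x ≡ x′ × y ≡ y′
  ⟨,⟩-injective eq with proj₁ bijective eq
  ... | refl = refl , refl

  private
    -- The proof of surjectivity supplies an inverse as an Agda function; that its components are
    -- recursive is shown below.
    unpair : ℕ → ℕ × ℕ
    unpair t = proj₁ (proj₂ bijective t)

  left right : ℕ → ℕ
  left  = proj₁ ∘ unpair
  right = proj₂ ∘ unpair

  ⟨left,right⟩ : ∀ t → ⟨ left t , right t ⟩ ≡ t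
  ⟨left,right⟩ t = proj₂ (proj₂ bijective t) refl

  left-⟨,⟩ : ∀ x y → left ⟨ x , y ⟩ ≡ x
  left-⟨,⟩ x y = proj₁ (⟨,⟩-injective (⟨left,right⟩ ⟨ x , y ⟩))

  right-⟨,⟩ : ∀ x y → right ⟨ x , y ⟩ ≡ y
  right-⟨,⟩ x y = proj₂ (⟨,⟩-injective (⟨left,right⟩ ⟨ x , y ⟩))

  computable-⟨,⟩ : Computable₂ ⟨_,_⟩
  computable-⟨,⟩ = computable-resp (λ { (_ ∷ _ ∷ []) → refl }) computable

  -- `left t` is the only `x` with `⟨ x , y ⟩ ≡ t` for some `y ≤ t`. The bounded search for `y` is a
  -- product, the search for `x` a minimisation.
  computable-left : Computable {1} (left ∘ head)
  computable-left = computable-uniqueZero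
    (computable-∘₃ (computable-suc (computable-lookup (suc zero))))
    -- The factors range over `y < suc t`, which covers `right t` because a pair bounds its
    -- components.
    (λ { (t ∷ []) → <⇒∏≡0 {f = λ y → distance ⟨ left t , y ⟩ t}
           (s≤s (subst (right t ≤_) (⟨left,right⟩ t) (≥-right (left t) (right t))))
           (≡⇒distance≡0 (⟨left,right⟩ t)) })
    (λ { x (t ∷ []) eq →
           let y , eq′ = ∏≡0⇒∃ (suc t) (λ y → distance ⟨ x , y ⟩ t) eq in
           trans (sym (left-⟨,⟩ x y))
                 (cong left (distance≡0⇒≡ ⟨ x , y ⟩ t eq′)) })
    where
    noPair : Vec ℕ 3 → ℕ
    noPair (k ∷ x ∷ t ∷ []) = ∏[ k ] λ y → distance ⟨ x , y ⟩ t

    computable-noPair : Computable noPair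
    computable-noPair = computable-prec
      (computable-const 1)
      (computable-∘₂ _*_ computable-*
        (computable-∘₂ distance computable-distance
          (computable-∘₂ ⟨_,_⟩ computable-⟨,⟩
            (computable-lookup (suc (suc zero))) (computable-lookup zero))
          (computable-lookup (suc (suc (suc zero)))))
        (computable-lookup (suc zero)))
      (λ { (_ ∷ _ ∷ []) → refl }) (λ { _ (_ ∷ _ ∷ []) → refl })

    computable-∘₃ : ∀ {f : Vec ℕ 2 → ℕ} → Computable f →
      Computable (λ xs → noPair (f xs ∷ lookup xs zero ∷ lookup xs (suc zero) ∷ []))
    computable-∘₃ (c , c⇓) =
      comp (proj₁ computable-noPair) (c ∷ proj zero ∷ proj (suc zero) ∷ []) ,
      λ xs → ⇓comp (c⇓ xs ∷ ⇓proj ∷ ⇓proj ∷ []) (proj₂ computable-noPair _)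

  -- With `left` computable, `right t` is the unique `y` solving `⟨ left t , y ⟩ ≡ t`, so a single
  -- search suffices.
  computable-right : Computable {1} (right ∘ head)
  computable-right = computable-uniqueZero
    (computable-∘₂ distance computable-distance
      (computable-∘₂ ⟨_,_⟩ computable-⟨,⟩
        (computable-∘₁ computable-left (computable-lookup (suc zero)))
        (computable-lookup zero))
      (computable-lookup (suc zero)))
    (λ { (t ∷ []) → ≡⇒distance≡0 (⟨left,right⟩ t) })
    (λ { y (t ∷ []) eq →
           trans (sym (right-⟨,⟩ (left t) y))
                 (cong right (distance≡0⇒≡ ⟨ left t , y ⟩ t eq)) })

  tuple-injective : ∀ {m} {x y : Vec ℕ (suc m)} → tuple π x ≡ tuple π y → x ≡ y
  tuple-injective {zero}  {_ ∷ []}    {_ ∷ []}    refl = refl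
  tuple-injective {suc m} {_ ∷ _ ∷ _} {_ ∷ _ ∷ _} eq with ⟨,⟩-injective eq
  ... | refl , eq′ = cong (_∷_ _) (tuple-injective eq′)

  tuple-surjective : ∀ m u → ∃[ x ] tuple π {m} x ≡ u
  tuple-surjective zero    u = [ u ] , refl
  tuple-surjective (suc m) u with tuple-surjective m (right u)
  ... | y ∷ ys , eq =
    left u ∷ y ∷ ys , trans (cong ⟨ left u ,_⟩ eq) (⟨left,right⟩ u)

  computable-tuple-replicate :
    ∀ m → Computable {1} (λ xs → tuple π (replicate (suc m) (head xs)))
  computable-tuple-replicate zero    =
    computable-resp (λ { (_ ∷ []) → refl }) (computable-lookup zero)
  computable-tuple-replicate (suc m) =
    computable-resp (λ { (_ ∷ []) → refl })
      (computable-∘₂ ⟨_,_⟩ computable-⟨,⟩ (computable-lookup zero)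
                                          (computable-tuple-replicate m))

  -- Here `u` codes a point of arity `suc m`. A coordinate `x` contributes `suc x ∸ a`, which is
  -- zero exactly when `x < a`, so the sum vanishes exactly on the cube.
  cubeTest : ℕ → ℕ → ℕ → ℕ
  cubeTest a zero    u = suc u ∸ a
  cubeTest a (suc m) u = (suc (left u) ∸ a) + cubeTest a m (right u)

  computable-cubeTest : ∀ a m → Computable {1} (cubeTest a m ∘ head)
  computable-cubeTest a zero    = computable-resp (λ { (_ ∷ []) → refl })
    (computable-∘₂ _∸_ computable-∸ (computable-suc (computable-lookup zero))
                                    (computable-const a))
  computable-cubeTest a (suc m) = computable-∘₂ _+_ computable-+
    (computable-∘₂ _∸_ computable-∸ (computable-suc computable-left)
                                    (computable-const a))
    (computable-∘₁ (computable-cubeTest a m) computable-right)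

  cube⇒cubeTest≡0 : ∀ {a m} {x : Vec ℕ (suc m)} → Cube (suc m) a x →
                    cubeTest a m (tuple π x) ≡ 0
  cube⇒cubeTest≡0 {m = zero}  {_ ∷ []} (x<a ∷ []) = m≤n⇒m∸n≡0 x<a
  cube⇒cubeTest≡0 {a} {suc m} {x ∷ xs@(_ ∷ _)} (x<a ∷ xs<a)
    rewrite left-⟨,⟩ x (tuple π xs) | right-⟨,⟩ x (tuple π xs) =
    cong₂ _+_ (m≤n⇒m∸n≡0 x<a) (cube⇒cubeTest≡0 xs<a)

  cubeTest≡0⇒cube : ∀ {a m} (x : Vec ℕ (suc m)) →
                    cubeTest a m (tuple π x) ≡ 0 → Cube (suc m) a x
  cubeTest≡0⇒cube {m = zero}  (_ ∷ []) eq = m∸n≡0⇒m≤n eq ∷ []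
  cubeTest≡0⇒cube {a} {suc m} (x ∷ xs@(_ ∷ _)) eq
    rewrite left-⟨,⟩ x (tuple π xs) | right-⟨,⟩ x (tuple π xs) =
    m∸n≡0⇒m≤n (m+n≡0⇒m≡0 (suc x ∸ a) eq) ∷
    cubeTest≡0⇒cube xs (m+n≡0⇒n≡0 (suc x ∸ a) eq)

-- Edge lengths and the functions used in the reduction.

cube-zeros : ∀ n {a} → 0 < a → Cube n a (replicate n 0)
cube-zeros zero    0<a = []
cube-zeros (suc n) 0<a = 0<a ∷ cube-zeros n 0<a

module _ {n : ℕ} (q r : PartialFunction n) (q≈r : q ≈ r) where

  ≈⇒Dom-⊆ : ∀ {x} → Dom q x → Dom r x
  ≈⇒Dom-⊆ = map₂ (proj₁ q≈r)

  ≈⇒Dom-⊇ : ∀ {x} → Dom r x → Dom q x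
  ≈⇒Dom-⊇ = map₂ (proj₂ q≈r)

  Anf-resp-≈ : ∀ {A} → q ∈ Anf n A → r ∈ Anf n A
  Anf-resp-≈ (inj₁ empty-q) = inj₁ λ x d → empty-q x (≈⇒Dom-⊇ d)
  Anf-resp-≈ (inj₂ (a , a∈A , ⊆cube , cube⊆)) =
    inj₂ (a , a∈A , (λ d → ⊆cube (≈⇒Dom-⊇ d)) , (λ x<a → ≈⇒Dom-⊆ (cube⊆ x<a)))

-- Positive arity matters: no coordinate is below 0, whereas in arity 0 the cube of edge 0 contains
-- the empty vector.
edgeLength≡0⇒Empty : ∀ {m} {D : Pred (Vec ℕ (suc m)) 0ℓ} →
                     EdgeLength D 0 → Empty D
edgeLength≡0⇒Empty (empty ¬D)        = ¬D
edgeLength≡0⇒Empty (cube (⊆cube , _)) (_ ∷ _) d with ⊆cube d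
... | () ∷ _

-- A cube of positive edge contains the origin.
Empty⇒edgeLength≡0 : ∀ {n b} {D : Pred (Vec ℕ n) 0ℓ} →
                     Empty D → EdgeLength D b → b ≡ 0
Empty⇒edgeLength≡0 ¬D (empty _) = refl
Empty⇒edgeLength≡0 {b = zero}  ¬D (cube _) = refl
Empty⇒edgeLength≡0 {n} {suc b} ¬D (cube (_ , cube⊆)) =
  ⊥-elim (¬D _ (cube⊆ (cube-zeros n (s≤s z≤n))))

-- Putting `P` into the graph as a conjunct defines the function without deciding `P`.
zeroOnCubeIf : ∀ n → ℕ → Set → PartialFunction n
zeroOnCubeIf n a P .Graph x y = P × Cube n a x × y ≡ 0
zeroOnCubeIf n a P .functional (_ , _ , refl) (_ , _ , refl) = refl

zeroOnCubeIf-yes : ∀ {n a P A} → a ∈ A → P → zeroOnCubeIf n a P ∈ Anf n A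
zeroOnCubeIf-yes a∈A p =
  inj₂ (_ , a∈A , (λ { (_ , _ , x<a , _) → x<a }) , λ x<a → 0 , p , x<a , refl)

zeroOnCubeIf-no : ∀ {n a P} → ¬ P → Empty (Dom (zeroOnCubeIf n a P))
zeroOnCubeIf-no ¬p _ (_ , p , _) = ¬p p

-- The diagonal set and its undecidability.

module _ (π : Pairing) {A : Pred ℕ 0ℓ} {m : ℕ} {θ : ℕ → PartialFunction (suc m)}
         (qgn : IsQuasiGödelNumbering π A θ) where
  open Pairing π
  open IsQuasiGödelNumbering qgn
  open IsNumbering isNumbering

  Diagonal : ℕ → Set
  Diagonal i = Graph (θ i) (replicate (suc m) i) 0

  -- Let `e` be an index of the total function that applies `d` to its first argument. Then
  -- `Diagonal e` holds exactly when `d [ e ] ≡ 0`, the opposite of what `decides` says at `e`.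
  Diagonal-undecidable : ∀ {d} → Computable {1} d →
                         ¬ (∀ i → (Diagonal i → d [ i ] ≢ 0) ×
                                  (¬ Diagonal i → d [ i ] ≡ 0))
  Diagonal-undecidable {d} cd decides =
    ¬diagonal-e (θe-⊇ (proj₂ (decides e) ¬diagonal-e))
    where
    q : PartialFunction (suc m)
    q .Graph x y = d [ lookup x zero ] ≡ y
    q .functional refl refl = refl

    θ-index : ∃[ i ] θ i ≈ q
    θ-index = onto q (inj₁ (_ , computable-∘₁ cd (computable-lookup zero) ,
                            (λ eq → eq) , (λ eq → eq)))

    e : ℕ
    e = proj₁ θ-index

    θe-⊇ : d [ e ] ≡ 0 → Diagonal e
    θe-⊇ = proj₂ (proj₂ θ-index)

    ¬diagonal-e : ¬ Diagonal e
    ¬diagonal-e diagonal-e =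
      proj₁ (decides e) diagonal-e (proj₁ (proj₂ θ-index) diagonal-e)

  private
    f : ℕ → ℕ
    f t = proj₁ qgn-I [ t ]

    -- The entry of the universal function's extended graph that records `Diagonal i`: the index and
    -- its `suc m` arguments are all `i`, and the value 0 is stored as 1.
    code : ℕ → ℕ
    code i = ⟨ tuple π (replicate (suc (suc m)) i) , 1 ⟩

  Diagonal⇒hit : ∀ {i} → Diagonal i → ∃[ s ] f s ≡ code i
  Diagonal⇒hit {i} diagonal =
    proj₁ (proj₂ (proj₂ qgn-I)) (inj₂ (i ∷ replicate _ i , 0 , diagonal , refl))

  hit⇒Diagonal : ∀ {i} s → f s ≡ code i → Diagonal i
  hit⇒Diagonal s eq with proj₂ (proj₂ (proj₂ qgn-I)) (s , eq)
  -- Default entries have second component 0, so a hit on `code i` must come from the graph.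
  ... | inj₁ (_ , eq′) with () ← proj₂ (⟨,⟩-injective π eq′)
  ... | inj₂ (x , z , graph , eq′) with ⟨,⟩-injective π eq′
  ... | eqˣ , refl with tuple-injective π {x = replicate _ _} {y = x} eqˣ
  ... | refl = graph

  -- Ensures that ⟨ u , 0 ⟩ is enumerated even when ⟨ u , 1 ⟩ is.
  miss : ∀ i → ∃[ s ] f s ≢ code i
  miss i with proj₁ (proj₂ (proj₂ qgn-I)) (inj₁ (replicate _ 0 , refl))
  ... | s , fs≡ = s , λ eq → 0≢1+n (proj₂ (⟨,⟩-injective π (trans (sym fs≡) eq)))

  -- Uniform enumeration of the extended graphs.

  module _ (a : ℕ) where

    private
      test : ℕ → ℕ → ℕ → ℕ
      test i u s = cubeTest π a m u + distance (f s) (code i)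

      test≡0⇒hit : ∀ i u s → test i u s ≡ 0 → f s ≡ code i
      test≡0⇒hit i u s eq =
        distance≡0⇒≡ (f s) (code i) (m+n≡0⇒n≡0 (cubeTest π a m u) eq)

    -- At t = ⟨ u , s ⟩ the value is ⟨ u , 1 ⟩ if u codes a point of the cube and
    -- s witnesses Diagonal i, and ⟨ u , 0 ⟩ otherwise.
    enumerate : ℕ → ℕ → ℕ
    enumerate i t = ⟨ left π t , 1 ∸ test i (left π t) (right π t) ⟩

    computable-enumerate : Computable₂ enumerate
    computable-enumerate = computable-∘₂ ⟨_,_⟩ (computable-⟨,⟩ π)
      (computable-∘₁ (computable-left π) (computable-lookup (suc zero)))
      (computable-∘₂ _∸_ computable-∸ (computable-const 1)
        (computable-∘₂ _+_ computable-+
          (computable-∘₁ (computable-cubeTest π a m)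
            (computable-∘₁ (computable-left π) (computable-lookup (suc zero))))
          (computable-∘₂ distance computable-distance
            (computable-∘₁ (proj₁ (proj₂ qgn-I))
              (computable-∘₁ (computable-right π) (computable-lookup (suc zero))))
            (computable-∘₂ ⟨_,_⟩ (computable-⟨,⟩ π)
              (computable-∘₁ (computable-tuple-replicate π (suc m))
                             (computable-lookup zero))
              (computable-const 1)))))

    enumerate-⟨,⟩ : ∀ i u s → enumerate i ⟨ u , s ⟩ ≡ ⟨ u , 1 ∸ test i u s ⟩
    enumerate-⟨,⟩ i u s =
      cong₂ (λ u s → ⟨ u , 1 ∸ test i u s ⟩) (left-⟨,⟩ π u s) (right-⟨,⟩ π u s)

    zeroOnCube : ℕ → PartialFunction (suc m)
    zeroOnCube i = zeroOnCubeIf (suc m) a (Diagonal i)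

    -- For completeness, `miss` supplies an `s` yielding each default entry, and `Diagonal⇒hit` an
    -- `s` yielding each graph entry. Only the number `test` is split on, so `Diagonal i` need not
    -- be decided.
    Range-enumerate : ∀ i → Range (enumerate i) ≐ ExtendedGraph π (zeroOnCube i)
    Range-enumerate i = (λ { (t , refl) → sound t }) , complete
      where
      sound : ∀ t → ExtendedGraph π (zeroOnCube i) (enumerate i t)
      sound t with tuple-surjective π m (left π t)
                 | test i (left π t) (right π t) in eq
      ... | x , x≡ | suc z = inj₁ (x , cong₂ ⟨_,_⟩ (sym x≡) (0∸n≡0 z))
      ... | x , x≡ | zero  = inj₂
        ( x , 0
        , ( hit⇒Diagonal (right π t) (test≡0⇒hit i (left π t) (right π t) eq)
          , cubeTest≡0⇒cube π x
              (trans (cong (cubeTest π a m) x≡) (m+n≡0⇒m≡0 _ eq))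
          , refl )
        , cong ⟨_, 1 ⟩ (sym x≡) )

      complete : ∀ {c} → ExtendedGraph π (zeroOnCube i) c → Range (enumerate i) c
      complete (inj₁ (y , refl)) with miss i
      ... | s , fs≢ = ⟨ tuple π y , s ⟩ ,
        trans (enumerate-⟨,⟩ i (tuple π y) s) (cong ⟨ tuple π y ,_⟩ test>0)
        where
        test>0 : 1 ∸ test i (tuple π y) s ≡ 0
        test>0 with test i (tuple π y) s in eq
        ... | zero  = ⊥-elim (fs≢ (test≡0⇒hit i (tuple π y) s eq))
        ... | suc z = 0∸n≡0 z
      complete (inj₂ (x , _ , (diagonal , x<a , refl) , refl))
        with Diagonal⇒hit diagonal
      ... | s , fs≡ = ⟨ tuple π x , s ⟩ ,
        trans (enumerate-⟨,⟩ i (tuple π x) s)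
          (cong (λ z → ⟨ tuple π x , 1 ∸ z ⟩)
            (cong₂ _+_ (cube⇒cubeTest≡0 π x<a) (≡⇒distance≡0 fs≡)))

  -- Deciding the diagonal set from edge lengths.

  noEdgeLength : ∀ {a} → a ∈ A → 0 < a → ∀ {p} → Computable {1} p →
    ¬ (∀ i → θ i ∈ Anf (suc m) A → EdgeLength (Dom (θ i)) (p [ i ]))
  noEdgeLength {a} a∈A 0<a {p} cp p-edge
    with qgn-II (λ xs → enumerate a (lookup xs zero) (lookup xs (suc zero)))
                (computable-enumerate a)
  ... | v , cv , v-index =
    Diagonal-undecidable (computable-∘₁ cp cv) λ i → p≢0 i , p≡0 i
    where
    -- Membership in `Anf` is assumed because each of its alternatives would settle `Diagonal i`;
    -- `p≢0` and `p≡0` supply it in their respective cases.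
    index : ∀ i → zeroOnCube a i ∈ Anf (suc m) A → zeroOnCube a i ≈ θ (v [ i ])
    index i r∈Anf = v-index i (zeroOnCube a i) (inj₂ r∈Anf) (Range-enumerate a i)

    edge : ∀ i → zeroOnCube a i ∈ Anf (suc m) A →
           EdgeLength (Dom (θ (v [ i ]))) (p [ v [ i ] ])
    edge i r∈Anf = p-edge (v [ i ])
      (Anf-resp-≈ (zeroOnCube a i) (θ (v [ i ])) (index i r∈Anf) r∈Anf)

    p≢0 : ∀ i → Diagonal i → p [ v [ i ] ] ≢ 0
    p≢0 i diagonal eq =
      -- The contradiction is at the origin, which lies in the domain since `0 < a`.
      edgeLength≡0⇒Empty (subst (EdgeLength _) eq (edge i r∈Anf)) _
        (≈⇒Dom-⊆ (zeroOnCube a i) (θ (v [ i ])) (index i r∈Anf)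
          (0 , diagonal , cube-zeros (suc m) 0<a , refl))
      where
      r∈Anf : zeroOnCube a i ∈ Anf (suc m) A
      r∈Anf = zeroOnCubeIf-yes a∈A diagonal

    p≡0 : ∀ i → ¬ Diagonal i → p [ v [ i ] ] ≡ 0
    p≡0 i ¬diagonal = Empty⇒edgeLength≡0
      (λ x d → ¬r x (≈⇒Dom-⊇ (zeroOnCube a i) (θ (v [ i ])) (index i (inj₁ ¬r)) d))
      (edge i (inj₁ ¬r))
      where
      ¬r : Empty (Dom (zeroOnCube a i))
      ¬r = zeroOnCubeIf-no ¬diagonal

corollary4p18 : (π : Pairing) (A : Pred ℕ 0ℓ) → Inf A → CE A →
    (m : ℕ) (θ : ℕ → PartialFunction (suc m)) →
    IsQuasiGödelNumbering π A θ →
    ¬ (∃[ p ] Computable {1} p ×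
    (∀ i → θ i ∈ Anf (suc m) A → EdgeLength (Dom (θ i)) (p [ i ])))
corollary4p18 π A A-inf _ m θ qgn (p , cp , p-edge) =
  -- `Inf` denies that some bound has no member of `A` at or above it. Refuting every positive
  -- member would make 1 such a bound, so no member has to be extracted.
  A-inf (1 , λ a 0<a a∈A → noEdgeLength π qgn a∈A 0<a cp p-edge)
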